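{- Suppose the maximum degree $\Delta$ of any vertex of $G$ is at most $m^{1/2-\alpha}$, where $\alpha>0$, and $t\le C\le\min(m^{2\alpha},m^{1/3})$. Then the expected number (over the random coloring) of $2k$-tuples $\vec T=(\vec T_1,\vec T_2)$ of edges of $\vec G$ such that $\vec T_1$ and $\vec T_2$ are both distinctly color-compatible, $\vec T$ satisfies Condition 1, 2 or 3 at every vertex of $H$, and $\vec T$ satisfies Condition 2 at some vertex of $H$, is $O(m^k/C^{2k-t})$, with implied constant depending only on $H$.
   Context: $H$ is a fixed connected finite simple graph with no leaves, vertices $1,\dots,t$, $k$ edges, oriented arbitrarily as $\vec H$ with directed edges $\overrightarrow{a_1a_2},\dots,\overrightarrow{a_{2k-1}a_{2k}}$, $a_i\in\{1,\dots,t\}$; $\Gamma(b)=\{i\in\{1,\dots,2k\}:a_i=b\}$. $G$ is a finite simple graph; $\vec G$ replaces each edge $vw$ by $\overrightarrow{vw},\overrightarrow{wv}$; $m$ is the number of edges of $\vec G$. A coloring $\mathcal C:V(G)\to\{1,\dots,C\}$ is chosen uniformly from a $4k$-wise independent family of hash functions, each value uniform. A $k$-tuple $(\overrightarrow{u_1u_2},\dots,\overrightarrow{u_{2k-1}u_{2k}})$ of edges of $\vec G$ is distinctly color-compatible if there are pairwise distinct colors $c_1,\dots,c_t$ with $\mathcal C(u_i)=c_{a_i}$ for all $1\le i\le 2k$. Write $\vec T_1=(\overrightarrow{v_1v_2},\dots,\overrightarrow{v_{2k-1}v_{2k}})$, $\vec T_2=(\overrightarrow{w_1w_2},\dots,\overrightarrow{w_{2k-1}w_{2k}})$.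 Conditions at a vertex $b$ of $H$: Condition 1: the $v_i$, $i\in\Gamma(b)$, are all equal and the $w_i$, $i\in\Gamma(b)$, are all equal. Condition 2: $v_i=w_i$ for all $i\in\Gamma(b)$. Condition 3: there are vertices $x,y$ of $G$ such that for every $i\in\Gamma(b)$, either ($v_i=x$, $w_i=y$) or ($v_i=y$, $w_i=x$). -}

module Defs where

open import Data.Nat using (ℕ; zero; suc; _+_; _*_; _^_; _≤_; _<_; _⊔_)
open import Data.Fin using (Fin; zero; suc)
open import Data.Bool using (Bool; true; false; if_then_else_)
open import Data.Product using (Σ; Σ-syntax; _×_; _,_; proj₁; proj₂)
open import Data.Sum using (_⊎_)
open import Data.Vec using (Vec; lookup; map)
open import Data.List using (List; length)
open import Data.List.Relation.Unary.All using (All)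
open import Data.List.Membership.Propositional using (_∈_)
open import Data.List.Relation.Unary.Unique.Propositional using (Unique)
open import Relation.Binary.PropositionalEquality using (_≡_; _≢_)
open import Relation.Nullary using (¬_)
open import Function.Definitions using (Injective)

sumFin : (n : ℕ) → (Fin n → ℕ) → ℕ
sumFin zero    f = 0
sumFin (suc n) f = f zero + sumFin n (λ i → f (suc i))

countB : (n : ℕ) → (Fin n → Bool) → ℕ
countB n p = sumFin n (λ i → if p i then 1 else 0)

maxFin : (n : ℕ) → (Fin n → ℕ) → ℕ
maxFin zero    f = 0
maxFin (suc n) f = f zero ⊔ maxFin n (λ i → f (suc i))

-- "N is the number of elements x of A with P x":
-- there is a duplicate-free list, of length N, whose members are exactly
-- the x satisfying P.  (Works for non-propositional P.)
IsCount : {A : Set} → (A → Set) → ℕ → Set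
IsCount {A} P N =
  Σ[ xs ∈ List A ] (Unique xs × length xs ≡ N × ((x : A) → (x ∈ xs → P x) × (P x → x ∈ xs)))

record SimpleGraph (n : ℕ) : Set where
  field
    adj   : Fin n → Fin n → Bool
    sym   : ∀ v w → adj v w ≡ adj w v
    irrefl : ∀ v → adj v v ≡ false
open SimpleGraph public

deg : {n : ℕ} → SimpleGraph n → Fin n → ℕ
deg {n} G v = countB n (adj G v)

maxDeg : {n : ℕ} → SimpleGraph n → ℕ
maxDeg {n} G = maxFin n (deg G)

-- m = number of directed edges of G⃗ = number of ordered pairs (v,w) with vw ∈ E(G)
numArcs : {n : ℕ} → SimpleGraph n → ℕ
numArcs {n} G = sumFin n (λ v → countB n (adj G v))

end : {A : Set} → A × A → Fin 2 → A
end e zero    = proj₁ e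
end e (suc _) = proj₂ e

-- Positions 1..2k are encoded as pairs (i , s) : Fin k × Fin 2
-- (position 2i+1+s in the paper's 1-based numbering).
Pos : ℕ → Set
Pos k = Fin k × Fin 2

-- The pattern graph H: vertices Fin t, k directed edges a_{2i-1} → a_{2i},
-- given as a vector of ordered pairs.

aH : {t k : ℕ} → Vec (Fin t × Fin t) k → Pos k → Fin t
aH hE (i , s) = end (lookup hE i) s

IsSimpleH : {t k : ℕ} → Vec (Fin t × Fin t) k → Set
IsSimpleH {t} {k} hE =
  ((i : Fin k) → proj₁ (lookup hE i) ≢ proj₂ (lookup hE i)) ×
  ((i j : Fin k) → (lookup hE i ≡ lookup hE j) ⊎
                   ((proj₁ (lookup hE i) ≡ proj₂ (lookup hE j)) × (proj₂ (lookup hE i) ≡ proj₁ (lookup hE j)))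
                 → i ≡ j)

AdjH : {t k : ℕ} → Vec (Fin t × Fin t) k → Fin t → Fin t → Set
AdjH {t} {k} hE x y =
  Σ[ i ∈ Fin k ] (((proj₁ (lookup hE i) ≡ x) × (proj₂ (lookup hE i) ≡ y)) ⊎
                  ((proj₁ (lookup hE i) ≡ y) × (proj₂ (lookup hE i) ≡ x)))

data Reach {t k : ℕ} (hE : Vec (Fin t × Fin t) k) (x : Fin t) : Fin t → Set where
  here : Reach hE x x
  step : ∀ {y z} → Reach hE x y → AdjH hE y z → Reach hE x z

IsConnectedH : {t k : ℕ} → Vec (Fin t × Fin t) k → Set
IsConnectedH {t} hE = (x y : Fin t) → Reach hE x y

InΓ : {t k : ℕ} → Vec (Fin t × Fin t) k → Fin t → Pos k → Set
InΓ hE b p = aH hE p ≡ b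

NoLeavesH : {t k : ℕ} → Vec (Fin t × Fin t) k → Set
NoLeavesH {t} {k} hE = (b : Fin t) (d : ℕ) → IsCount (InΓ hE b) d → d ≢ 1

Tuple : ℕ → ℕ → Set
Tuple n k = Vec (Fin n × Fin n) k

pos : {n k : ℕ} → Tuple n k → Pos k → Fin n
pos T (i , s) = end (lookup T i) s

IsArcTuple : {n k : ℕ} → SimpleGraph n → Tuple n k → Set
IsArcTuple {n} {k} G T = (i : Fin k) → adj G (proj₁ (lookup T i)) (proj₂ (lookup T i)) ≡ true

DistinctlyCompatible : {t k n C : ℕ} → Vec (Fin t × Fin t) k → (Fin n → Fin C) → Tuple n k → Set
DistinctlyCompatible {t} {k} {n} {C} hE col T =
  Σ[ c ∈ (Fin t → Fin C) ] (Injective _≡_ _≡_ c × ((p : Pos k) → col (pos T p) ≡ c (aH hE p)))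

Condition1 : {t k n : ℕ} → Vec (Fin t × Fin t) k → Fin t → Tuple n k → Tuple n k → Set
Condition1 {t} {k} hE b T₁ T₂ =
  (p q : Pos k) → InΓ hE b p → InΓ hE b q → (pos T₁ p ≡ pos T₁ q) × (pos T₂ p ≡ pos T₂ q)

Condition2 : {t k n : ℕ} → Vec (Fin t × Fin t) k → Fin t → Tuple n k → Tuple n k → Set
Condition2 {t} {k} hE b T₁ T₂ = (p : Pos k) → InΓ hE b p → pos T₁ p ≡ pos T₂ p

Condition3 : {t k n : ℕ} → Vec (Fin t × Fin t) k → Fin t → Tuple n k → Tuple n k → Set
Condition3 {t} {k} {n} hE b T₁ T₂ =
  Σ[ x ∈ Fin n ] Σ[ y ∈ Fin n ] ((p : Pos k) → InΓ hE b p →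
     ((pos T₁ p ≡ x) × (pos T₂ p ≡ y)) ⊎ ((pos T₁ p ≡ y) × (pos T₂ p ≡ x)))

Good : {t k n C : ℕ} → Vec (Fin t × Fin t) k → SimpleGraph n → (Fin n → Fin C) →
       Tuple n k × Tuple n k → Set
Good {t} {k} {n} {C} hE G col (T₁ , T₂) =
  IsArcTuple G T₁ × IsArcTuple G T₂ ×
  DistinctlyCompatible hE col T₁ × DistinctlyCompatible hE col T₂ ×
  ((b : Fin t) → Condition1 hE b T₁ T₂ ⊎ Condition2 hE b T₁ T₂ ⊎ Condition3 hE b T₁ T₂) ×
  Σ[ b ∈ Fin t ] Condition2 hE b T₁ T₂

-- r-wise independent family of hash functions fam : Fin F → (Fin n → Fin C),
-- chosen uniformly: for any r' ≤ r pairwise distinct vertices and any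
-- prescribed colors, exactly a 1/C^{r'} fraction of the family realises them.

Distinct : {n r : ℕ} → Vec (Fin n) r → Set
Distinct {n} {r} xs = Injective _≡_ _≡_ (lookup xs)

IsIndependentFamily : {n C F : ℕ} → ℕ → (Fin F → Fin n → Fin C) → Set
IsIndependentFamily {n} {C} {F} r fam =
  (r' : ℕ) → r' ≤ r → (xs : Vec (Fin n) r') → Distinct xs → (cs : Vec (Fin C) r') →
  (M : ℕ) → IsCount (λ j → map (fam j) xs ≡ cs) M → M * C ^ r' ≡ F

{-# OPTIONS --safe #-}
-- Fix a pair (T₁ , T₂) and call a vertex b of H fixed if T₁ and T₂ use the same set of vertices of G
-- at b, and free otherwise; Condition 1 holds at free vertices. Let V be the number of distinct
-- vertices of G in the pair, r the number of components of the graph formed by its 2k arcs, and β the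
-- number of free vertices. There are at most C^(t+β) admissible colour prescriptions, each realised
-- with probability C^(-V), and the number of pairs with a given shape is at most m^r Δ^(V-2r), whose
-- square is at most m^V C^(2r-V). The exponents work out from V ≤ 2k (as H has no leaves, every
-- vertex occurs on two half-edges) and r + β ≤ k. For the latter, each component contains an arc
-- of T₁ and a half-edge at a fixed vertex (by connectivity of H), while each free vertex it meets
-- has degree at least 2; hence it has more T₁-arcs than free vertices visited by T₁.
module Submission where

open import Defs renaming (sym to adj-sym; irrefl to adj-irrefl)
open import Data.Bool using (Bool; true; false; not; if_then_else_)
import Data.Bool as Bool
open import Data.Empty using (⊥-elim)
open import Data.Fin using (Fin; zero; suc)
import Data.Fin as Fin
open import Data.Fin.Properties using (all?; any?; injective⇒≤)
open import Data.List using (List; []; _∷_; _++_; length; filter; tabulate; allFin; concatMap; cartesianProductWith; cartesianProduct; upTo)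
import Data.List as List
open import Data.List.Properties using (length-++; length-map; length-tabulate; length-filter)
open import Data.List.Membership.Propositional using (_∈_; find; lose)
open import Data.List.Membership.Propositional.Properties using
  (∈-allFin; ∈-filter⁺; ∈-filter⁻; ∈-cartesianProduct⁺; ∈-cartesianProduct⁻; ∈-cartesianProductWith⁺; ∈-concatMap⁺;
   ∈-map⁺; ∈-++⁺ˡ; ∈-++⁺ʳ; ∈-upTo⁺)
open import Data.List.Relation.Unary.All using (All; []; _∷_)
open import Data.List.Relation.Unary.AllPairs using ([]; _∷_)
open import Data.List.Relation.Unary.Any using (Any; here; there)
import Data.List.Relation.Unary.Any as Any
open import Data.List.Relation.Unary.Unique.Propositional using (Unique)
import Data.List.Relation.Unary.Unique.Propositional.Properties as Unique
open import Data.Nat using (ℕ; zero; suc; _+_; _*_; _^_; _≤_; _<_; z≤n; s≤s; _≤?_; NonZero; >-nonZero)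
open import Data.Nat.Properties
open import Data.Nat.Solver using (module +-*-Solver)
open +-*-Solver using (solve; _:=_; _:+_; _:*_)
open import Data.Product using (Σ-syntax; ∃; ∃-syntax; _×_; _,_; proj₁; proj₂)
import Data.Product.Properties as Product
import Data.Sum as Sum
open import Data.Sum using (_⊎_; inj₁; inj₂)
open import Data.Vec using (Vec; []; _∷_; lookup)
import Data.Vec as Vec
import Data.Vec.Properties as Vec
open import Function using (_∘_; id)
open import Relation.Binary.PropositionalEquality using (_≡_; _≢_; refl; sym; trans; cong; cong₂; subst; module ≡-Reasoning)
open import Relation.Nullary using (¬_; Dec; yes; no; does; contradiction; ¬?)
open import Relation.Nullary.Decidable using (_×-dec_; _→-dec_)
import Relation.Nullary.Decidable as Dec
open import Relation.Unary using (Decidable)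
open import Relation.Binary.Definitions using (DecidableEquality)

-- Finite sums over lists

private variable
  A B : Set
  P Q : Set

∑ : List A → (A → ℕ) → ℕ
∑ []       f = 0
∑ (x ∷ xs) f = f x + ∑ xs f

∑-mono : (xs : List A) {f g : A → ℕ} → (∀ x → f x ≤ g x) → ∑ xs f ≤ ∑ xs g
∑-mono []       f≤g = z≤n
∑-mono (x ∷ xs) f≤g = +-mono-≤ (f≤g x) (∑-mono xs f≤g)

∑-mono-< : (xs : List A) {f g : A → ℕ} {y : A} → (∀ x → f x ≤ g x) →
           y ∈ xs → f y < g y → ∑ xs f < ∑ xs g
∑-mono-< (x ∷ xs) f≤g (here refl) fy<gy = +-mono-<-≤ fy<gy (∑-mono xs f≤g)
∑-mono-< (x ∷ xs) f≤g (there y∈)  fy<gy = +-mono-≤-< (f≤g x) (∑-mono-< xs f≤g y∈ fy<gy)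

∑-cong : (xs : List A) {f g : A → ℕ} → (∀ x → f x ≡ g x) → ∑ xs f ≡ ∑ xs g
∑-cong []       f≡g = refl
∑-cong (x ∷ xs) f≡g = cong₂ _+_ (f≡g x) (∑-cong xs f≡g)

∑-const : (xs : List A) (c : ℕ) → ∑ xs (λ _ → c) ≡ length xs * c
∑-const []       c = refl
∑-const (x ∷ xs) c = cong (c +_) (∑-const xs c)

∑-+ : (xs : List A) (f g : A → ℕ) → ∑ xs (λ x → f x + g x) ≡ ∑ xs f + ∑ xs g
∑-+ []       f g = refl
∑-+ (x ∷ xs) f g rewrite ∑-+ xs f g =
  solve 4 (λ a b c d → a :+ b :+ (c :+ d) := a :+ c :+ (b :+ d)) refl (f x) (g x) (∑ xs f) (∑ xs g)


∑-*ʳ : (xs : List A) (f : A → ℕ) (c : ℕ) → ∑ xs (λ x → f x * c) ≡ ∑ xs f * c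
∑-*ʳ []       f c = refl
∑-*ʳ (x ∷ xs) f c = trans (cong (f x * c +_) (∑-*ʳ xs f c)) (sym (*-distribʳ-+ c (f x) (∑ xs f)))

∑-bound : (xs : List A) {f : A → ℕ} {c : ℕ} → (∀ {x} → x ∈ xs → f x ≤ c) → ∑ xs f ≤ length xs * c
∑-bound []       f≤c = z≤n
∑-bound (x ∷ xs) f≤c = +-mono-≤ (f≤c (here refl)) (∑-bound xs (f≤c ∘ there))

∑-swap : (xs : List A) (ys : List B) (f : A → B → ℕ) →
         ∑ xs (λ x → ∑ ys (f x)) ≡ ∑ ys (λ y → ∑ xs (λ x → f x y))
∑-swap []       ys f = sym (trans (∑-const ys 0) (*-zeroʳ (length ys)))
∑-swap (x ∷ xs) ys f = trans (cong (∑ ys (f x) +_) (∑-swap xs ys f))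
                             (sym (∑-+ ys (f x) (λ y → ∑ xs (λ x′ → f x′ y))))

∑-++ : (xs ys : List A) (f : A → ℕ) → ∑ (xs ++ ys) f ≡ ∑ xs f + ∑ ys f
∑-++ []       ys f = refl
∑-++ (x ∷ xs) ys f = trans (cong (f x +_) (∑-++ xs ys f)) (sym (+-assoc (f x) _ _))

∑-map : (g : A → B) (xs : List A) (f : B → ℕ) → ∑ (List.map g xs) f ≡ ∑ xs (f ∘ g)
∑-map g []       f = refl
∑-map g (x ∷ xs) f = cong (f (g x) +_) (∑-map g xs f)

∑-cartesianProduct : (xs : List A) (ys : List B) (f : A × B → ℕ) →
                     ∑ (cartesianProduct xs ys) f ≡ ∑ xs (λ x → ∑ ys (λ y → f (x , y)))
∑-cartesianProduct []       ys f = refl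
∑-cartesianProduct (x ∷ xs) ys f =
  trans (∑-++ (List.map (x ,_) ys) _ f)
        (cong₂ _+_ (∑-map (x ,_) ys f) (∑-cartesianProduct xs ys f))

∑-allFin : (n : ℕ) (f : Fin n → ℕ) → ∑ (allFin n) f ≡ sumFin n f
∑-allFin n f = go n id
  where
  go : (m : ℕ) (g : Fin m → Fin n) → ∑ (tabulate g) f ≡ sumFin m (f ∘ g)
  go zero    g = refl
  go (suc m) g = cong (f (g zero) +_) (go m (g ∘ suc))

∑-≥-term : {xs : List A} (f : A → ℕ) {p : A} → p ∈ xs → f p ≤ ∑ xs f
∑-≥-term {xs = x ∷ xs} f (here refl) = m≤m+n (f x) _
∑-≥-term {xs = x ∷ xs} f (there p∈)  = ≤-trans (∑-≥-term f p∈) (m≤n+m _ (f x))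

∑-≥-two-terms : {xs : List A} (f : A → ℕ) {p q : A} → p ∈ xs → q ∈ xs → p ≢ q → f p + f q ≤ ∑ xs f
∑-≥-two-terms f (here refl) (here refl) p≢q = contradiction refl p≢q
∑-≥-two-terms {xs = x ∷ xs} f (here refl) (there q∈) p≢q = +-monoʳ-≤ (f x) (∑-≥-term f q∈)
∑-≥-two-terms {xs = x ∷ xs} f {p} (there p∈) (here refl) p≢q =
  ≤-trans (≤-reflexive (+-comm (f p) (f x))) (+-monoʳ-≤ (f x) (∑-≥-term f p∈))
∑-≥-two-terms {xs = x ∷ xs} f (there p∈) (there q∈) p≢q =
  ≤-trans (∑-≥-two-terms f p∈ q∈ p≢q) (m≤n+m _ (f x))

length-concatMap : (f : A → List B) (xs : List A) → length (concatMap f xs) ≡ ∑ xs (length ∘ f)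
length-concatMap f []       = refl
length-concatMap f (x ∷ xs) = trans (length-++ (f x)) (cong (length (f x) +_) (length-concatMap f xs))

length-cartesianProductWith : {D : Set} (f : A → B → D) (xs : List A) (ys : List B) →
  length (cartesianProductWith f xs ys) ≡ length xs * length ys
length-cartesianProductWith f []       ys = refl
length-cartesianProductWith f (x ∷ xs) ys =
  trans (length-++ (List.map (f x) ys)) (cong₂ _+_ (length-map (f x) ys) (length-cartesianProductWith f xs ys))

-- Indicators and counting

⟦_⟧ : Dec P → ℕ
⟦ d ⟧ = if does d then 1 else 0

⟦⟧-yes : (d : Dec P) → P → ⟦ d ⟧ ≡ 1
⟦⟧-yes (yes _) p = refl
⟦⟧-yes (no ¬p) p = contradiction p ¬p

⟦⟧-no : (d : Dec P) → ¬ P → ⟦ d ⟧ ≡ 0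
⟦⟧-no (yes p) ¬p = contradiction p ¬p
⟦⟧-no (no _)  ¬p = refl

⟦⟧-≤1 : (d : Dec P) → ⟦ d ⟧ ≤ 1
⟦⟧-≤1 (yes _) = ≤-refl
⟦⟧-≤1 (no _)  = z≤n

∑-at-most-one : {R : A → Set} (R? : Decidable R) {xs : List A} → Unique xs →
  (∀ {x y} → R x → R y → x ≡ y) → ∑ xs (λ x → ⟦ R? x ⟧) ≤ 1
∑-at-most-one R? [] uniq = z≤n
∑-at-most-one {R = R} R? {x ∷ xs} (x∉xs ∷ u) uniq with R? x
... | no _   = ∑-at-most-one R? u uniq
... | yes rx = s≤s (≤-reflexive (none x∉xs))
  where
  none : ∀ {ys} → All (x ≢_) ys → ∑ ys (λ y → ⟦ R? y ⟧) ≡ 0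
  none []                   = refl
  none {y ∷ ys} (x≢y ∷ x≢s) = cong₂ _+_ (⟦⟧-no (R? y) (λ ry → x≢y (uniq rx ry))) (none x≢s)

length-filter-∑ : {R : A → Set} (R? : Decidable R) (xs : List A) →
  length (filter R? xs) ≡ ∑ xs (λ x → ⟦ R? x ⟧)
length-filter-∑ R? [] = refl
length-filter-∑ R? (x ∷ xs) with R? x
... | yes _ = cong suc (length-filter-∑ R? xs)
... | no _  = length-filter-∑ R? xs

-- Double counting of the equal pairs `(x , y)`: every `x` meets some `y`, and every `y` equals at
-- most one `x`.
unique-⊆-length : {xs ys : List A} → DecidableEquality A → Unique xs → (∀ {x} → x ∈ xs → x ∈ ys) →
  length xs ≤ length ys
unique-⊆-length {xs = xs} {ys} _≟_ u sub = begin
  length xs                                  ≡⟨ *-identityʳ _ ⟨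
  length xs * 1                              ≡⟨ ∑-const xs 1 ⟨
  ∑ xs (λ _ → 1)                             ≤⟨ covered xs sub ⟩
  ∑ xs (λ x → ∑ ys (λ y → ⟦ x ≟ y ⟧))        ≡⟨ ∑-swap xs ys _ ⟩
  ∑ ys (λ y → ∑ xs (λ x → ⟦ x ≟ y ⟧))        ≤⟨ ∑-bound ys (λ {y} _ → ∑-at-most-one (_≟ y) u (λ p q → trans p (sym q))) ⟩
  length ys * 1                              ≡⟨ *-identityʳ _ ⟩
  length ys                                  ∎
  where
  open ≤-Reasoning
  covered : ∀ zs → (∀ {x} → x ∈ zs → x ∈ ys) → ∑ zs (λ _ → 1) ≤ ∑ zs (λ x → ∑ ys (λ y → ⟦ x ≟ y ⟧))
  covered []       _ = z≤n
  covered (z ∷ zs) s = +-mono-≤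
    (≤-trans (≤-reflexive (sym (⟦⟧-yes (z ≟ z) refl))) (∑-≥-term (λ y → ⟦ z ≟ y ⟧) (s (here refl))))
    (covered zs (s ∘ there))

-- Exhaustive lists of finite types

record Listing (A : Set) : Set where
  field
    elements : List A
    complete : ∀ x → x ∈ elements
open Listing

search : Listing A → {R : A → Set} → Decidable R → Dec (∃ R)
search L R? = Dec.map′ (λ a → let x , _ , r = find a in x , r) (λ (x , r) → lose (complete L x) r)
                       (Any.any? R? (elements L))

listFin : (n : ℕ) → Listing (Fin n)
listFin n = record { elements = allFin n ; complete = ∈-allFin }

listBool : Listing Bool
listBool = record { elements = false ∷ true ∷ [] ; complete = λ { false → here refl ; true → there (here refl) } }

infixr 2 _⊗_
_⊗_ : Listing A → Listing B → Listing (A × B)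
L ⊗ M = record
  { elements = cartesianProduct (elements L) (elements M)
  ; complete = λ (x , y) → ∈-cartesianProduct⁺ (complete L x) (complete M y) }

listVec : Listing A → (n : ℕ) → Listing (Vec A n)
listVec L zero    = record { elements = [] ∷ [] ; complete = λ { [] → here refl } }
listVec L (suc n) = record
  { elements = cartesianProductWith _∷_ (elements L) (elements (listVec L n))
  ; complete = λ { (x ∷ xs) → ∈-cartesianProductWith⁺ _∷_ (complete L x) (complete (listVec L n) xs) } }

length-listVec : (L : Listing A) (n : ℕ) → length (elements (listVec L n)) ≡ length (elements L) ^ n
length-listVec L zero    = refl
length-listVec L (suc n) = trans (length-cartesianProductWith _∷_ (elements L) _)
                                 (cong (length (elements L) *_) (length-listVec L n))

-- Orders of exploration

-- An order of exploring a graph on V vertices: `arc` starts a new component with an arc,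
-- `extend l` adds a neighbour of the l-th vertex. Vertices are numbered from the latest one.
data Exploration : ℕ → Set where
  start  : Exploration 0
  arc    : ∀ {V} → Exploration V → Exploration (2 + V)
  extend : ∀ {V} → Fin V → Exploration V → Exploration (suc V)

components : ∀ {V} → Exploration V → ℕ
components start        = 0
components (arc e)      = suc (components e)
components (extend _ e) = components e

explorations : (V : ℕ) → List (Exploration V)
explorations zero          = start ∷ []
-- No exploration has one vertex: `arc` adds two, and `extend` would need an element of `Fin 0`.
explorations (suc zero)    = []
explorations (suc (suc V)) = List.map arc (explorations V)
                             ++ cartesianProductWith extend (allFin (suc V)) (explorations (suc V))

∈-explorations : ∀ {V} (e : Exploration V) → e ∈ explorations V
∈-explorations start                  = here refl
∈-explorations (arc e)                = ∈-++⁺ˡ (∈-map⁺ arc (∈-explorations e))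
∈-explorations (extend {V = suc V} l e) =
  ∈-++⁺ʳ (List.map arc (explorations V)) (∈-cartesianProductWith⁺ extend (∈-allFin l) (∈-explorations e))

listExploration : (V : ℕ) → Listing (Exploration V)
listExploration V = record { elements = explorations V ; complete = ∈-explorations }

-- Counting embeddings of an exploration into `G`

module _ {n : ℕ} (G : SimpleGraph n) where

  neighbours : Fin n → List (Fin n)
  neighbours v = filter (λ w → adj G v w Bool.≟ true) (allFin n)

  arcs : List (Fin n × Fin n)
  arcs = filter (λ (v , w) → adj G v w Bool.≟ true) (cartesianProduct (allFin n) (allFin n))

  ⟦≟true⟧ : ∀ b → ⟦ b Bool.≟ true ⟧ ≡ (if b then 1 else 0)
  ⟦≟true⟧ true  = refl
  ⟦≟true⟧ false = refl

  ∑-adj : ∀ v → ∑ (allFin n) (λ w → ⟦ adj G v w Bool.≟ true ⟧) ≡ deg G v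
  ∑-adj v = trans (∑-cong (allFin n) (λ w → ⟦≟true⟧ (adj G v w))) (∑-allFin n _)

  ≤-maxFin : ∀ {l} (f : Fin l → ℕ) i → f i ≤ maxFin l f
  ≤-maxFin {suc l} f zero    = m≤m⊔n (f zero) _
  ≤-maxFin {suc l} f (suc i) = ≤-trans (≤-maxFin (f ∘ suc) i) (m≤n⊔m (f zero) _)

  length-neighbours : ∀ v → length (neighbours v) ≤ maxDeg G
  length-neighbours v = ≤-trans
    (≤-reflexive (trans (length-filter-∑ _ (allFin n)) (∑-adj v)))
    (≤-maxFin (deg G) v)

  length-arcs : length arcs ≡ numArcs G
  length-arcs = begin
    length arcs                                                       ≡⟨ length-filter-∑ _ (cartesianProduct (allFin n) (allFin n)) ⟩
    ∑ (cartesianProduct (allFin n) (allFin n)) _                      ≡⟨ ∑-cartesianProduct (allFin n) (allFin n) _ ⟩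
    ∑ (allFin n) (λ v → ∑ (allFin n) (λ w → ⟦ adj G v w Bool.≟ true ⟧)) ≡⟨ ∑-cong (allFin n) ∑-adj ⟩
    ∑ (allFin n) (deg G)                                              ≡⟨ ∑-allFin n _ ⟩
    numArcs G                                                         ∎
    where open ≡-Reasoning

  prependArc : ∀ {V} → Fin n × Fin n → Vec (Fin n) V → Vec (Fin n) (2 + V)
  prependArc (v , w) xs = v ∷ w ∷ xs

  -- These are the homomorphisms to `G` of the forest traced out by the exploration: only the arc
  -- along which a vertex was found is enforced, and repeated vertices are filtered out later.
  embeddings : ∀ {V} → Exploration V → List (Vec (Fin n) V)
  embeddings start        = [] ∷ []
  embeddings (arc e)      = cartesianProductWith prependArc arcs (embeddings e)
  embeddings (extend l e) = concatMap (λ xs → List.map (_∷ xs) (neighbours (lookup xs l))) (embeddings e)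

  ∈-embeddings-arc : ∀ {V} (e : Exploration V) {xs v w} → adj G v w ≡ true →
                     xs ∈ embeddings e → (v ∷ w ∷ xs) ∈ embeddings (arc e)
  ∈-embeddings-arc e vw xs∈ = ∈-cartesianProductWith⁺ prependArc
    (∈-filter⁺ (λ (v , w) → adj G v w Bool.≟ true) (∈-cartesianProduct⁺ (∈-allFin _) (∈-allFin _)) vw) xs∈

  ∈-embeddings-extend : ∀ {V} (e : Exploration V) {xs w} l → adj G (lookup xs l) w ≡ true →
                        xs ∈ embeddings e → (w ∷ xs) ∈ embeddings (extend l e)
  ∈-embeddings-extend e l vw xs∈ =
    ∈-concatMap⁺ _ (lose xs∈ (∈-map⁺ _ (∈-filter⁺ _ (∈-allFin _) vw)))

  -- Squared, because m is only compared with Δ².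
  embeddings-bound : ∀ {C V} (e : Exploration V) → maxDeg G * maxDeg G * C ≤ numArcs G →
    length (embeddings e) * length (embeddings e) * C ^ V
      ≤ numArcs G ^ V * (C ^ components e * C ^ components e)
  embeddings-bound start _ = ≤-refl
  embeddings-bound {C} {suc (suc V)} (arc e) h = begin
    length (embeddings (arc e)) * length (embeddings (arc e)) * (C * (C * C ^ V))
      ≡⟨ cong (λ z → z * z * (C * (C * C ^ V)))
           (trans (length-cartesianProductWith _ arcs (embeddings e)) (cong (_* N) length-arcs)) ⟩
    m * N * (m * N) * (C * (C * C ^ V))
      ≡⟨ solve 4 (λ m N C D → m :* N :* (m :* N) :* (C :* (C :* D)) := m :* m :* (C :* C) :* (N :* N :* D))
           refl m N C (C ^ V) ⟩
    m * m * (C * C) * (N * N * C ^ V)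
      -- The factor `m * m` accounts for the two new vertices, and `C * C` for the new component.
      ≤⟨ *-monoʳ-≤ (m * m * (C * C)) (embeddings-bound e h) ⟩
    m * m * (C * C) * (m ^ V * (R * R))
      ≡⟨ solve 4 (λ m C D R → m :* m :* (C :* C) :* (D :* (R :* R)) := m :* (m :* D) :* (C :* R :* (C :* R)))
           refl m C (m ^ V) R ⟩
    m * (m * m ^ V) * (C * R * (C * R)) ∎
    where
    open ≤-Reasoning
    m = numArcs G
    N = length (embeddings e)
    R = C ^ components e
  embeddings-bound {C} {suc V} (extend l e) h = begin
    length (embeddings (extend l e)) * length (embeddings (extend l e)) * (C * C ^ V)
      ≤⟨ *-monoˡ-≤ (C * C ^ V) (*-mono-≤ step-bound step-bound) ⟩
    N * D * (N * D) * (C * C ^ V)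
      ≡⟨ solve 4 (λ N D C E → N :* D :* (N :* D) :* (C :* E) := D :* D :* C :* (N :* N :* E))
           refl N D C (C ^ V) ⟩
    D * D * C * (N * N * C ^ V)
      -- The `D` choices, squared, together with the `C` of the new vertex cost a single `m`.
      ≤⟨ *-mono-≤ h (embeddings-bound e h) ⟩
    m * (m ^ V * (R * R))
      ≡⟨ *-assoc m (m ^ V) (R * R) ⟨
    m * m ^ V * (R * R) ∎
    where
    open ≤-Reasoning
    m = numArcs G
    D = maxDeg G
    N = length (embeddings e)
    R = C ^ components e
    step-bound : length (embeddings (extend l e)) ≤ N * D
    step-bound = ≤-trans (≤-reflexive (length-concatMap _ (embeddings e)))
      (∑-bound (embeddings e) (λ {xs} _ → ≤-trans (≤-reflexive (length-map (_∷ xs) (neighbours (lookup xs l))))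
                                              (length-neighbours (lookup xs l))))

-- Comparison of exponents

sqrt-mono : ∀ {x y} → x * x ≤ y * y → x ≤ y
sqrt-mono x²≤y² = ≮⇒≥ (λ y<x → <⇒≱ (*-mono-< y<x y<x) x²≤y²)

-- Each of the 2k − V missing vertices costs a factor m ≥ C³.
exponent-bound : ∀ {e C m V r β k} → 0 < C → C ^ 3 ≤ m → V ≤ 2 * k → r + β ≤ k →
  e * e * C ^ V ≤ m ^ V * (C ^ r * C ^ r) → e * C ^ β * C ^ (2 * k) ≤ m ^ k * C ^ V
exponent-bound {e} {C} {m} {V} {r} {β} {k} 0<C C³≤m V≤2k r+β≤k h with m≤n⇒∃[o]m+o≡n V≤2k
-- `d` counts the vertices missing from `2 * k`. The claim is squared and multiplied by `C ^ V` so
-- that `h` applies to its left-hand side.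
... | d , V+d≡2k = sqrt-mono (*-cancelʳ-≤ _ _ (C ^ V) {{m^n≢0 C V {{C≢0}}}} (begin
  e * b * C ^ (2 * k) * (e * b * C ^ (2 * k)) * C ^ V
    ≡⟨ cong (λ z → e * b * z * (e * b * z) * C ^ V) (square C) ⟩
  e * b * (s * s) * (e * b * (s * s)) * C ^ V
    ≡⟨ solve 4 (λ e b s v → e :* b :* (s :* s) :* (e :* b :* (s :* s)) :* v := e :* e :* v :* (b :* b :* (s :* s :* (s :* s))))
         refl e b s (C ^ V) ⟩
  e * e * C ^ V * (b * b * (s * s * (s * s)))
    ≤⟨ *-monoˡ-≤ (b * b * (s * s * (s * s))) h ⟩
  m ^ V * (a * a) * (b * b * (s * s * (s * s)))
    ≡⟨ solve 4 (λ u a b s → u :* (a :* a) :* (b :* b :* (s :* s :* (s :* s))) := u :* ((a :* b) :* (a :* b) :* (s :* s :* (s :* s))))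
         refl (m ^ V) a b s ⟩
  m ^ V * (a * b * (a * b) * (s * s * (s * s)))
    ≤⟨ *-monoʳ-≤ (m ^ V) (*-monoˡ-≤ (s * s * (s * s)) (*-mono-≤ ab≤s ab≤s)) ⟩
  m ^ V * (s * s * (s * s * (s * s)))
    ≡⟨ cong (λ z → m ^ V * (z * (z * z))) s²≡ ⟩
  m ^ V * (v * w * (v * w * (v * w)))
    ≡⟨ solve 3 (λ u v w → u :* (v :* w :* (v :* w :* (v :* w))) := (w :* (w :* w)) :* u :* (v :* v) :* v) refl (m ^ V) v w ⟩
  w * (w * w) * m ^ V * (v * v) * v
    ≤⟨ *-monoˡ-≤ v (*-monoˡ-≤ (v * v) (*-monoˡ-≤ (m ^ V) w³≤)) ⟩
  m ^ d * m ^ V * (v * v) * v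
    ≡⟨ cong (λ z → z * (v * v) * v) (trans (*-comm (m ^ d) (m ^ V)) (trans (sym (^-distribˡ-+-* m V d)) (trans (cong (m ^_) V+d≡2k) (square m)))) ⟩
  m ^ k * m ^ k * (v * v) * v
    ≡⟨ solve 2 (λ x v → x :* x :* (v :* v) :* v := x :* v :* (x :* v) :* v) refl (m ^ k) v ⟩
  m ^ k * v * (m ^ k * v) * v ∎))
  where
  open ≤-Reasoning
  C≢0 : NonZero C
  C≢0 = >-nonZero 0<C
  a = C ^ r
  b = C ^ β
  s = C ^ k
  v = C ^ V
  w = C ^ d
  square : ∀ x → x ^ (2 * k) ≡ x ^ k * x ^ k
  square x = trans (^-distribˡ-+-* x k (k + 0)) (cong (λ z → x ^ k * x ^ z) (+-identityʳ k))
  ab≤s : a * b ≤ s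
  ab≤s = ≤-trans (≤-reflexive (sym (^-distribˡ-+-* C r β))) (^-monoʳ-≤ C {{C≢0}} r+β≤k)
  s²≡ : s * s ≡ v * w
  s²≡ = trans (sym (square C)) (trans (cong (C ^_) (sym V+d≡2k)) (^-distribˡ-+-* C V d))
  w³≤ : w * (w * w) ≤ m ^ d
  w³≤ = ≤-trans (≤-reflexive (trans (cong (λ z → w * (w * z)) (sym (*-identityʳ w)))
                  (trans (^-*-assoc C d 3) (trans (cong (C ^_) (*-comm d 3)) (sym (^-*-assoc C 3 d))))))
                (^-monoˡ-≤ d C³≤m)

-- Patterns of pairs and their enumeration

-- How the vertices of a pair (T₁ , T₂) arise from an exploration. The half-edges of the pair are
-- (false , p) for T₁ and (true , p) for T₂; `vertexAt` and `halfEdgeOf` translate between half-edges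
-- and explored vertices, and `freeMask` marks the vertices of H whose colours in T₁ and T₂ may differ.
record Pattern (t k : ℕ) : Set where
  constructor pattern′
  field
    V          : ℕ
    order      : Exploration V
    vertexAt   : Tuple V k × Tuple V k
    halfEdgeOf : Vec (Bool × Pos k) V
    freeMask   : Vec Bool t

  freeCount : ℕ
  freeCount = countB t (lookup freeMask)

  -- These are the two inequalities that `exponent-bound` consumes; the first also leaves only
  -- finitely many patterns.
  Admissible : Set
  Admissible = V ≤ 2 * k × components order + freeCount ≤ k

  admissible? : Dec Admissible
  admissible? = (V ≤? 2 * k) ×-dec (components order + freeCount ≤? k)

  decode : ∀ {n} → Vec (Fin n) V → Tuple n k × Tuple n k
  decode xs = let D , D′ = vertexAt in Vec.map at D , Vec.map at D′
    where at = λ (v , w) → lookup xs v , lookup xs w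
open Pattern

listPair : (V k : ℕ) → Listing (Tuple V k)
listPair V k = listVec (listFin V ⊗ listFin V) k

patternsOn : (t k V : ℕ) → List (Pattern t k)
patternsOn t k V = List.map (λ (e , D , h , f) → pattern′ V e D h f)
  (elements (listExploration V ⊗ (listPair V k ⊗ listPair V k)
             ⊗ listVec (listBool ⊗ listFin k ⊗ listFin 2) V ⊗ listVec listBool t))

patterns : (t k : ℕ) → List (Pattern t k)
patterns t k = filter admissible? (concatMap (patternsOn t k) (upTo (suc (2 * k))))

∈-patterns : ∀ {t k} (π : Pattern t k) → Admissible π → π ∈ patterns t k
∈-patterns {t} {k} π adm = ∈-filter⁺ admissible?
  (∈-concatMap⁺ (patternsOn t k) (lose (∈-upTo⁺ (s≤s (proj₁ adm)))
    (∈-map⁺ _ (complete (listExploration (V π) ⊗ (listPair (V π) k ⊗ listPair (V π) k)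
             ⊗ listVec (listBool ⊗ listFin k ⊗ listFin 2) (V π) ⊗ listVec listBool t) _)))) adm

patterns-admissible : ∀ {t k} {π : Pattern t k} → π ∈ patterns t k → Admissible π
patterns-admissible {t} {k} π∈ = proj₂ (∈-filter⁻ admissible? {xs = concatMap (patternsOn t k) (upTo (suc (2 * k)))} π∈)

-- Colour prescriptions

-- At a vertex of `H` that is not free, `T₁` and `T₂` use the same vertices of `G`, so one colour
-- serves both; only free vertices offer a new choice.
secondColourings : ∀ {t C} → Vec Bool t → Vec (Fin C) t → List (Vec (Fin C) t)
secondColourings []           []       = [] ∷ []
secondColourings (true ∷ fs)  (_ ∷ cs) = cartesianProductWith _∷_ (allFin _) (secondColourings fs cs)
secondColourings (false ∷ fs) (c ∷ cs) = List.map (c ∷_) (secondColourings fs cs)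

length-secondColourings : ∀ {t C} (fs : Vec Bool t) (cs : Vec (Fin C) t) →
  length (secondColourings fs cs) ≡ C ^ countB t (lookup fs)
length-secondColourings []           []       = refl
length-secondColourings {C = C} (true ∷ fs)  (_ ∷ cs) =
  trans (length-cartesianProductWith _∷_ (allFin C) (secondColourings fs cs))
        (cong₂ _*_ (length-tabulate {n = C} id) (length-secondColourings fs cs))
length-secondColourings (false ∷ fs) (c ∷ cs) =
  trans (length-map (c ∷_) (secondColourings fs cs)) (length-secondColourings fs cs)

∈-secondColourings : ∀ {t C} (fs : Vec Bool t) {cs ds : Vec (Fin C) t} →
  (∀ b → lookup fs b ≡ false → lookup ds b ≡ lookup cs b) → ds ∈ secondColourings fs cs
∈-secondColourings []           {[]}     {[]}     _ = here refl
∈-secondColourings (true ∷ fs)  {_ ∷ _}  {_ ∷ _}  h =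
  ∈-cartesianProductWith⁺ _∷_ (∈-allFin _) (∈-secondColourings fs (h ∘ suc))
∈-secondColourings (false ∷ fs) {c ∷ cs} {d ∷ ds} h with h zero refl
... | refl = ∈-map⁺ (c ∷_) (∈-secondColourings fs (h ∘ suc))

colouringPairs : ∀ {t} (C : ℕ) → Vec Bool t → List (Vec (Fin C) t × Vec (Fin C) t)
colouringPairs {t} C fs = concatMap (λ c → List.map (c ,_) (secondColourings fs c)) (elements (listVec (listFin C) t))

∈-colouringPairs : ∀ {t C} (fs : Vec Bool t) {cs ds : Vec (Fin C) t} →
  (∀ b → lookup fs b ≡ false → lookup ds b ≡ lookup cs b) → (cs , ds) ∈ colouringPairs C fs
∈-colouringPairs {t} {C} fs {cs} h = ∈-concatMap⁺ (λ c → List.map (c ,_) (secondColourings fs c)) (lose (complete (listVec (listFin C) t) cs)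
  (∈-map⁺ (cs ,_) (∈-secondColourings fs h)))

length-colouringPairs : ∀ {t C} (fs : Vec Bool t) →
  length (colouringPairs C fs) ≡ C ^ t * C ^ countB t (lookup fs)
length-colouringPairs {t} {C} fs = begin
  length (colouringPairs C fs)                  ≡⟨ length-concatMap _ cs ⟩
  ∑ cs _                                        ≡⟨ ∑-cong cs (λ c → trans (length-map (c ,_) (secondColourings fs c)) (length-secondColourings fs c)) ⟩
  ∑ cs (λ _ → C ^ countB t (lookup fs))         ≡⟨ ∑-const cs _ ⟩
  length cs * C ^ countB t (lookup fs)          ≡⟨ cong (_* C ^ countB t (lookup fs)) (trans (length-listVec (listFin C) t) (cong (_^ t) (length-tabulate {n = C} id))) ⟩
  C ^ t * C ^ countB t (lookup fs)              ∎
  where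
  open ≡-Reasoning
  cs = elements (listVec (listFin C) t)

-- The expected number of realisations

distinct? : ∀ {n V} (xs : Vec (Fin n) V) → Dec (Distinct xs)
distinct? xs = Dec.map′ (λ d {i} {j} → d i j) (λ d i j → d {i} {j})
  (all? (λ i → all? (λ j → (lookup xs i Fin.≟ lookup xs j) →-dec (i Fin.≟ j))))

module _ {t k n C F : ℕ} (hE : Vec (Fin t × Fin t) k) (G : SimpleGraph n) (fam : Fin F → Fin n → Fin C) where

  distinctEmbeddings : ∀ {V} → Exploration V → List (Vec (Fin n) V)
  distinctEmbeddings e = filter distinct? (embeddings G e)

  Instance : Pattern t k → Set
  Instance π = Vec (Fin n) (V π) × (Vec (Fin C) t × Vec (Fin C) t)

  instances : (π : Pattern t k) → List (Instance π)
  instances π = cartesianProduct (distinctEmbeddings (order π)) (colouringPairs C (freeMask π))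

  length-instances : ∀ π → length (instances π) ≤ length (embeddings G (order π)) * (C ^ t * C ^ freeCount π)
  length-instances π = ≤-trans
    (≤-reflexive (length-cartesianProductWith _,_ (distinctEmbeddings (order π)) _))
    (*-mono-≤ (length-filter distinct? (embeddings G (order π)))
              (≤-reflexive (length-colouringPairs (freeMask π))))

  -- Each explored vertex is tested through its one recorded half-edge, so that an instance imposes
  -- exactly `V π` conditions, one on each vertex.
  prescribed : (π : Pattern t k) → Vec (Fin C) t × Vec (Fin C) t → Vec (Fin C) (V π)
  prescribed π (c , d) = Vec.map (λ (s , p) → lookup (if s then d else c) (aH hE p)) (halfEdgeOf π)

  Realises : Fin F → (π : Pattern t k) → Instance π → Set
  Realises j π (xs , cd) = Vec.map (fam j) xs ≡ prescribed π cd

  realises? : ∀ j π → Decidable (Realises j π)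
  realises? j π (xs , cd) = Vec.≡-dec Fin._≟_ (Vec.map (fam j) xs) (prescribed π cd)

  realisations : Fin F → ℕ
  realisations j = ∑ (patterns t k) (λ π → ∑ (instances π) (λ i → ⟦ realises? j π i ⟧))

  module _ (1≤C : 1 ≤ C) (ind : IsIndependentFamily (4 * k) fam) where

    -- The vertices of an instance are distinct and number at most `2 * k`, within the range of the
    -- `4 * k`-wise independence; the filtered list of indices is the count that `ind` measures.
    probability : (π : Pattern t k) → Admissible π → ∀ {i} → i ∈ instances π →
      ∑ (allFin F) (λ j → ⟦ realises? j π i ⟧) * C ^ V π ≡ F
    probability π (V≤2k , _) {xs , cd} i∈ =
      ind (V π) (≤-trans V≤2k (*-monoˡ-≤ k {2} {4} (s≤s (s≤s z≤n)))) xs xs-distinct (prescribed π cd) _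
        ( filter real? (allFin F) , Unique.filter⁺ real? (Unique.allFin⁺ F) , length-filter-∑ real? (allFin F)
        , λ j → (λ j∈ → proj₂ (∈-filter⁻ real? {xs = allFin F} j∈)) , ∈-filter⁺ real? (∈-allFin j))
      where
      real? = λ j → realises? j π (xs , cd)
      xs-distinct : Distinct xs
      xs-distinct = proj₂ (∈-filter⁻ distinct? {xs = embeddings G (order π)}
        (proj₁ (∈-cartesianProduct⁻ (distinctEmbeddings (order π)) (colouringPairs C (freeMask π)) i∈)))

    -- Multiplying by `C ^ V π` turns the number of hash functions realising each instance into `F`;
    -- the number of instances is then left to `exponent-bound`.
    pattern-bound : maxDeg G * maxDeg G * C ≤ numArcs G → C ^ 3 ≤ numArcs G →
      (π : Pattern t k) → Admissible π →
      ∑ (instances π) (λ i → ∑ (allFin F) (λ j → ⟦ realises? j π i ⟧)) * C ^ (2 * k)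
        ≤ numArcs G ^ k * C ^ t * F
    pattern-bound Δ²C≤m C³≤m π adm =
      *-cancelʳ-≤ _ _ (C ^ V π) {{m^n≢0 C (V π) {{>-nonZero 1≤C}}}} (begin
        X * s * v
          ≡⟨ solve 3 (λ X s v → X :* s :* v := X :* v :* s) refl X s v ⟩
        X * v * s
          ≡⟨ cong (_* s) (∑-*ʳ (instances π) _ v) ⟨
        ∑ (instances π) (λ i → ∑ (allFin F) (λ j → ⟦ realises? j π i ⟧) * v) * s
          ≤⟨ *-monoˡ-≤ s (∑-bound (instances π) (λ i∈ → ≤-reflexive (probability π adm i∈))) ⟩
        length (instances π) * F * s
          ≤⟨ *-monoˡ-≤ s (*-monoˡ-≤ F (length-instances π)) ⟩
        e * (C ^ t * b) * F * s
          ≡⟨ solve 5 (λ e T b F s → e :* (T :* b) :* F :* s := e :* b :* s :* (T :* F)) refl e (C ^ t) b F s ⟩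
        e * b * s * (C ^ t * F)
          ≤⟨ *-monoˡ-≤ (C ^ t * F) (exponent-bound {e} {V = V π} {r = components (order π)} {β = freeCount π} {k = k} 1≤C C³≤m
               (proj₁ adm) (proj₂ adm) (embeddings-bound G (order π) Δ²C≤m)) ⟩
        numArcs G ^ k * v * (C ^ t * F)
          ≡⟨ solve 4 (λ m v T F → m :* v :* (T :* F) := m :* T :* F :* v) refl (numArcs G ^ k) v (C ^ t) F ⟩
        numArcs G ^ k * C ^ t * F * v ∎)
      where
      open ≤-Reasoning
      X = ∑ (instances π) (λ i → ∑ (allFin F) (λ j → ⟦ realises? j π i ⟧))
      s = C ^ (2 * k)
      v = C ^ V π
      b = C ^ freeCount π
      e = length (embeddings G (order π))

    -- Linearity of expectation: the sum over the family moves inside the sums over patterns and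
    -- instances, and `pattern-bound` is applied to each pattern.
    expectation-bound : maxDeg G * maxDeg G * C ≤ numArcs G → C ^ 3 ≤ numArcs G →
      (N : Fin F → ℕ) → (∀ j → N j ≤ realisations j) →
      sumFin F N * C ^ (2 * k) ≤ length (patterns t k) * numArcs G ^ k * C ^ t * F
    expectation-bound Δ²C≤m C³≤m N N≤ = begin
      sumFin F N * s
        ≡⟨ cong (_* s) (∑-allFin F N) ⟨
      ∑ (allFin F) N * s
        ≤⟨ *-monoˡ-≤ s (∑-mono (allFin F) N≤) ⟩
      ∑ (allFin F) realisations * s
        ≡⟨ cong (_* s) (∑-swap (allFin F) (patterns t k) _) ⟩
      ∑ (patterns t k) (λ π → ∑ (allFin F) (λ j → ∑ (instances π) (λ i → ⟦ realises? j π i ⟧))) * s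
        ≡⟨ cong (_* s) (∑-cong (patterns t k) (λ π → ∑-swap (allFin F) (instances π) _)) ⟩
      ∑ (patterns t k) (λ π → ∑ (instances π) (λ i → ∑ (allFin F) (λ j → ⟦ realises? j π i ⟧))) * s
        ≡⟨ ∑-*ʳ (patterns t k) _ s ⟨
      ∑ (patterns t k) (λ π → ∑ (instances π) (λ i → ∑ (allFin F) (λ j → ⟦ realises? j π i ⟧)) * s)
        ≤⟨ ∑-bound (patterns t k) (λ {π} π∈ → pattern-bound Δ²C≤m C³≤m π (patterns-admissible π∈)) ⟩
      length (patterns t k) * (numArcs G ^ k * C ^ t * F)
        ≡⟨ solve 4 (λ K m T F → K :* (m :* T :* F) := K :* m :* T :* F) refl (length (patterns t k)) (numArcs G ^ k) (C ^ t) F ⟩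
      length (patterns t k) * numArcs G ^ k * C ^ t * F ∎
      where
      open ≤-Reasoning
      s = C ^ (2 * k)

  -- Decoding the realised instances produces every pair satisfying `R`, possibly several times, so
  -- the count is only bounded.
  count-≤-realisations : (j : Fin F) {R : Tuple n k × Tuple n k → Set} {N : ℕ} → IsCount R N →
    (∀ {T} → R T → Σ[ π ∈ Pattern t k ] (Admissible π × Σ[ i ∈ Instance π ]
                     (i ∈ instances π × Realises j π i × decode π (proj₁ i) ≡ T))) →
    N ≤ realisations j
  count-≤-realisations j (Ts , unique , refl , spec) cover = begin
    length Ts                          ≤⟨ unique-⊆-length (Product.≡-dec tuple≟ tuple≟) unique decoded ⟩
    length (concatMap decodings (patterns t k)) ≡⟨ length-concatMap decodings (patterns t k) ⟩
    ∑ (patterns t k) (length ∘ decodings)       ≡⟨ ∑-cong (patterns t k) (λ π →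
        trans (length-map (decode π ∘ proj₁) (filter (realises? j π) (instances π)))
              (length-filter-∑ (realises? j π) (instances π))) ⟩
    realisations j                              ∎
    where
    open ≤-Reasoning
    tuple≟ : DecidableEquality (Tuple n k)
    tuple≟ = Vec.≡-dec (Product.≡-dec Fin._≟_ Fin._≟_)
    decodings : Pattern t k → List (Tuple n k × Tuple n k)
    decodings π = List.map (decode π ∘ proj₁) (filter (realises? j π) (instances π))
    decoded : ∀ {T} → T ∈ Ts → T ∈ concatMap decodings (patterns t k)
    decoded {T} T∈ with cover (proj₁ (spec T) T∈)
    ... | π , adm , i , i∈ , real , refl =
      ∈-concatMap⁺ decodings (lose (∈-patterns π adm) (∈-map⁺ (decode π ∘ proj₁) (∈-filter⁺ (realises? j π) i∈ real)))

-- Exploring the graph formed by the arcs of a pair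

-- With `d` read before and `e` after a stage of the exploration, the second summand counts what is
-- new.
⟦⟧-+-≤ : (d : Dec P) (e : Dec Q) → (P → Q) → ⟦ d ⟧ + ⟦ e ×-dec ¬? d ⟧ ≤ ⟦ e ⟧
⟦⟧-+-≤ (yes p) (yes q) f = ≤-refl
⟦⟧-+-≤ (yes p) (no ¬q) f = contradiction (f p) ¬q
⟦⟧-+-≤ (no ¬p) (yes q) f = ≤-refl
⟦⟧-+-≤ (no ¬p) (no ¬q) f = ≤-refl

⟦⟧-≤-+ : (d : Dec P) (e : Dec Q) → ⟦ e ⟧ ≤ ⟦ d ⟧ + ⟦ e ×-dec ¬? d ⟧
⟦⟧-≤-+ (yes p) (yes q) = ≤-refl
⟦⟧-≤-+ (yes p) (no ¬q) = z≤n
⟦⟧-≤-+ (no ¬p) (yes q) = ≤-refl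
⟦⟧-≤-+ (no ¬p) (no ¬q) = z≤n

⟦⟧-*-≤ : (d : Dec P) {c m : ℕ} → (P → c ≤ m) → ⟦ d ⟧ * c ≤ m
⟦⟧-*-≤ (yes p) {c} c≤m = ≤-trans (≤-reflexive (*-identityˡ c)) (c≤m p)
⟦⟧-*-≤ (no _)      c≤m = z≤n

if-≤ : (b : Bool) {m : ℕ} → (b ≡ true → 1 ≤ m) → (if b then 1 else 0) ≤ m
if-≤ true  1≤m = 1≤m refl
if-≤ false _   = z≤n

Distinct-∷ : ∀ {n V} {x : Fin n} {xs : Vec (Fin n) V} → Distinct xs → ¬ (∃[ l ] lookup xs l ≡ x) → Distinct (x ∷ xs)
Distinct-∷ d x∉ {zero}  {zero}  _  = refl
Distinct-∷ d x∉ {zero}  {suc j} eq = contradiction (j , sym eq) x∉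
Distinct-∷ d x∉ {suc i} {zero}  eq = contradiction (i , eq) x∉
Distinct-∷ d x∉ {suc i} {suc j} eq = cong suc (d eq)

other : Fin 2 → Fin 2
other zero    = suc zero
other (suc _) = zero

other-involutive : ∀ u → other (other u) ≡ u
other-involutive zero       = refl
other-involutive (suc zero) = refl

HalfEdge : ℕ → Set
HalfEdge k = Bool × Pos k

listPos : (k : ℕ) → Listing (Pos k)
listPos k = listFin k ⊗ listFin 2

listHalfEdge : (k : ℕ) → Listing (HalfEdge k)
listHalfEdge k = listBool ⊗ listPos k

-- The Conditions enter only through these parameters: `free-const` is Condition 1 at free vertices,
-- `swap` says that the two tuples use the same vertices of `G` at a fixed vertex, and `anchor` will
-- be a vertex with Condition 2. `paired` is the absence of leaves.
module Explore {t k n : ℕ} (hE : Vec (Fin t × Fin t) k) (conn : IsConnectedH hE)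
  (G : SimpleGraph n) (f : HalfEdge k → Fin n)
  (f-adj : ∀ s i u → adj G (f (s , i , u)) (f (s , i , other u)) ≡ true)
  (free : Fin t → Bool)
  (paired : ∀ p → ∃[ q ] (q ≢ p × aH hE q ≡ aH hE p))
  (free-const : ∀ s {p q} → free (aH hE p) ≡ true → aH hE q ≡ aH hE p → f (s , q) ≡ f (s , p))
  (swap : ∀ s p → free (aH hE p) ≡ false → ∃[ q ] (aH hE q ≡ aH hE p × f (not s , q) ≡ f (s , p)))
  (free-touched : ∀ b → free b ≡ true → ∃[ p ] aH hE p ≡ b)
  (anchor : Fin t) (anchor-fixed : free anchor ≡ false)
  where

  record State (V : ℕ) : Set where
    field
      vertices    : Vec (Fin n) V
      exploration : Exploration V
      origin      : Vec (HalfEdge k) V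
      embedded    : vertices ∈ embeddings G exploration
      distinct    : Distinct vertices
      origin-f    : ∀ l → f (lookup origin l) ≡ lookup vertices l
  open State

  infix 4 _∋_ _∋?_ _⊑_
  _∋_ : ∀ {V} → State V → Fin n → Set
  S ∋ v = ∃[ l ] lookup (vertices S) l ≡ v

  _∋?_ : ∀ {V} (S : State V) v → Dec (S ∋ v)
  S ∋? v = any? (λ l → lookup (vertices S) l Fin.≟ v)

  _⊑_ : ∀ {V W} → State V → State W → Set
  S ⊑ S′ = ∀ {v} → S ∋ v → S′ ∋ v

  -- The visited vertices then form a union of components of the graph formed by the `2k` arcs.
  Closed : ∀ {V} → State V → Set
  Closed S = ∀ s i u → S ∋ f (s , i , u) → S ∋ f (s , i , other u)

  size≤n : ∀ {V} → State V → V ≤ n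
  size≤n S = injective⇒≤ (distinct S)

  empty : State 0
  empty = record { vertices = [] ; exploration = start ; origin = [] ; embedded = here refl
                 ; distinct = λ { {()} } ; origin-f = λ () }

  extendState : ∀ {V} (S : State V) (l : Fin V) (h : HalfEdge k) →
    adj G (lookup (vertices S) l) (f h) ≡ true → ¬ S ∋ f h → State (suc V)
  extendState S l h adjacent new = record
    { vertices    = f h ∷ vertices S
    ; exploration = extend l (exploration S)
    ; origin      = h ∷ origin S
    ; embedded    = ∈-embeddings-extend G (exploration S) l adjacent (embedded S)
    ; distinct    = Distinct-∷ (distinct S) new
    ; origin-f    = λ { zero → refl ; (suc l′) → origin-f S l′ } }

  f-irrefl : ∀ s i u → f (s , i , u) ≢ f (s , i , other u)
  f-irrefl s i u eq with trans (sym (f-adj s i u)) (trans (cong (adj G (f (s , i , u))) (sym eq)) (adj-irrefl G _))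
  ... | ()

  arcState : ∀ {V} (S : State V) s i → (∀ u → ¬ S ∋ f (s , i , u)) → State (2 + V)
  arcState S s i new = record
    { vertices    = f (s , i , zero) ∷ f (s , i , suc zero) ∷ vertices S
    ; exploration = arc (exploration S)
    ; origin      = (s , i , zero) ∷ (s , i , suc zero) ∷ origin S
    ; embedded    = ∈-embeddings-arc G (exploration S) (f-adj s i zero) (embedded S)
    ; distinct    = Distinct-∷ (Distinct-∷ (distinct S) (new (suc zero)))
                      λ { (zero , eq) → f-irrefl s i (suc zero) eq ; (suc l , eq) → new zero (l , eq) }
    ; origin-f    = λ { zero → refl ; (suc zero) → refl ; (suc (suc l)) → origin-f S l } }

  arcState-∋ : ∀ {V} (S : State V) s i new u → arcState S s i new ∋ f (s , i , u)
  arcState-∋ S s i new zero       = zero , refl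
  arcState-∋ S s i new (suc zero) = suc zero , refl

  Closure : ∀ {V} → State V → Set
  Closure {V} S = Σ[ W ∈ ℕ ] Σ[ S′ ∈ State W ]
    (V ≤ W × S ⊑ S′ × Closed S′ × components (exploration S′) ≡ components (exploration S))

  fuel-spent : ∀ {V W} {X : Set} → suc V ≤ W → W ≤ n → n ≤ V + 0 → X
  fuel-spent {V} V<W W≤n n≤V =
    ⊥-elim (<-irrefl refl (≤-trans V<W (≤-trans W≤n (≤-trans n≤V (≤-reflexive (+-identityʳ V))))))

  fuel-step : ∀ {V W} fuel → suc V ≤ W → n ≤ V + suc fuel → n ≤ W + fuel
  fuel-step {V} fuel V<W n≤ = ≤-trans n≤ (≤-trans (≤-reflexive (+-suc V fuel)) (+-monoˡ-≤ fuel V<W))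

  -- While some arc leaves the state, its far end is added by `extend`, so no component is started.
  -- As `n ≤ V + fuel` persists and a state holds at most `n` distinct vertices, the fuel cannot run
  -- out early.
  close : ∀ fuel {V} (S : State V) → n ≤ V + fuel → Closure S
  close fuel {V} S n≤ with search (listHalfEdge k)
    (λ (s , i , u) → (S ∋? f (s , i , u)) ×-dec ¬? (S ∋? f (s , i , other u)))
  ... | no none = V , S , ≤-refl , id , closed , refl
    where
    closed : Closed S
    closed s i u v∈ with S ∋? f (s , i , other u)
    ... | yes w∈ = w∈
    ... | no w∉  = contradiction ((s , i , u) , v∈ , w∉) none
  ... | yes ((s , i , u) , (l , eq) , w∉) = grow fuel n≤
    where
    S⁺ : State (suc V)
    S⁺ = extendState S l (s , i , other u)
      (trans (cong (λ v → adj G v (f (s , i , other u))) eq) (f-adj s i u)) w∉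
    grow : ∀ fuel → n ≤ V + fuel → Closure S
    grow zero       n≤ = fuel-spent ≤-refl (size≤n S⁺) n≤
    grow (suc fuel) n≤ with close fuel S⁺ (fuel-step fuel ≤-refl n≤)
    ... | W , S′ , V<W , S⁺⊑ , closed , same =
      W , S′ , ≤-trans (n≤1+n V) V<W , (λ (l′ , eq′) → S⁺⊑ (suc l′ , eq′)) , closed , same

  -- Testing the first end suffices: in a closed state both ends of an arc are visited or neither
  -- is. Only arcs of `T₁` are counted.
  edgeVisited? : ∀ {V} (S : State V) i → Dec (S ∋ f (false , i , zero))
  edgeVisited? S i = S ∋? f (false , i , zero)

  FreeVisited : ∀ {V} → State V → Fin t → Set
  FreeVisited S b = free b ≡ true × ∃[ p ] (aH hE p ≡ b × S ∋ f (false , p))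

  freeVisited? : ∀ {V} (S : State V) b → Dec (FreeVisited S b)
  freeVisited? S b = (free b Bool.≟ true) ×-dec
    search (listPos k) (λ p → (aH hE p Fin.≟ b) ×-dec (S ∋? f (false , p)))

  edgesVisited freesVisited : ∀ {V} → State V → ℕ
  edgesVisited S = ∑ (allFin k) (λ i → ⟦ edgeVisited? S i ⟧)
  freesVisited S = ∑ (allFin t) (λ b → ⟦ freeVisited? S b ⟧)

  -- New arcs of `T₁` against new free vertices

  module Growth {V W} (S : State V) (S′ : State W) (S⊑S′ : S ⊑ S′) (closed : Closed S) (closed′ : Closed S′) where

    Fresh : Fin n → Set
    Fresh v = S′ ∋ v × ¬ S ∋ v

    -- Closedness of `S′` carries membership across the arc; closedness of `S`, read backwards,
    -- carries non-membership.
    fresh-other : ∀ {s i u} → Fresh (f (s , i , u)) → Fresh (f (s , i , other u))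
    fresh-other {s} {i} {u} (v∈ , v∉) = closed′ s i u v∈ ,
      λ w∈ → v∉ (subst (λ z → S ∋ f (s , i , z)) (other-involutive u) (closed s i (other u) w∈))

    fresh-zero : ∀ {s i} u → Fresh (f (s , i , u)) → Fresh (f (s , i , zero))
    fresh-zero zero       fr = fr
    fresh-zero (suc zero) fr = fresh-other fr

    FixedFresh : Bool → Set
    FixedFresh s = ∃[ p ] (free (aH hE p) ≡ false × Fresh (f (s , p)))

    -- If the common vertex of `H` is free, Condition 1 moves freshness from `p` to `(i , u)`, and
    -- closedness moves it along the arc; otherwise `p` itself is the fixed witness.
    cross : ∀ {s i p} u → aH hE p ≡ aH hE (i , u) → Fresh (f (s , p)) →
            FixedFresh s ⊎ Fresh (f (s , i , other u))
    cross {s} {i} {p} u eq fr with free (aH hE p) in free≡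
    ... | false = inj₁ (p , free≡ , fr)
    ... | true  = inj₂ (fresh-other (subst Fresh (sym (free-const s free≡ (sym eq))) fr))

    -- Connectivity of H carries a fresh half-edge along a walk to the anchor, unless it meets a fixed vertex before.
    walk : ∀ {s p y} → Fresh (f (s , p)) → Reach hE (aH hE p) y →
           FixedFresh s ⊎ ∃[ q ] (aH hE q ≡ y × Fresh (f (s , q)))
    walk fr here = inj₂ (_ , refl , fr)
    walk fr (step reach (i , ends)) with walk fr reach
    ... | inj₁ done = inj₁ done
    ... | inj₂ (q , refl , fr′) with ends
    ... | inj₁ (eq₁ , eq₂) = Sum.map₂ (λ fr″ → (i , suc zero) , eq₂ , fr″) (cross zero (sym eq₁) fr′)
    ... | inj₂ (eq₁ , eq₂) = Sum.map₂ (λ fr″ → (i , zero) , eq₁ , fr″) (cross (suc zero) (sym eq₂) fr′)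

    fixedFresh-any : ∀ {s p} → Fresh (f (s , p)) → FixedFresh s
    fixedFresh-any fr with walk fr (conn _ anchor)
    ... | inj₁ done             = done
    ... | inj₂ (q , refl , fr′) = q , anchor-fixed , fr′

    -- A fresh half-edge of `T₂` at a fixed vertex has a counterpart in `T₁` by `swap`, so the
    -- surplus is found among the arcs of `T₁`, the only ones counted.
    fixedFresh : ∀ {h} → Fresh (f h) → FixedFresh false
    fixedFresh {false , p} fr = fixedFresh-any fr
    fixedFresh {true , p}  fr with fixedFresh-any fr
    ... | q , fixed , fr′ with swap true q fixed
    ... | r , r~q , eq = r , trans (cong free r~q) fixed , subst Fresh (sym eq) fr′

    newEdge? : (i : Fin k) → Dec (Fresh (f (false , i , zero)))
    newEdge? i = edgeVisited? S′ i ×-dec ¬? (edgeVisited? S i)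

    newFree? : (b : Fin t) → Dec (FreeVisited S′ b × ¬ FreeVisited S b)
    newFree? b = freeVisited? S′ b ×-dec ¬? (freeVisited? S b)

    newEdges newFrees : ℕ
    newEdges = ∑ (allFin k) (λ i → ⟦ newEdge? i ⟧)
    newFrees = ∑ (allFin t) (λ b → ⟦ newFree? b ⟧)

    -- An entry of the incidence matrix for a double count of new arcs of `T₁` against vertices of
    -- `H`; the row sums are `freshDegree`.
    freshAt : Fin t → Pos k → ℕ
    freshAt b p = ⟦ aH hE p Fin.≟ b ⟧ * ⟦ newEdge? (proj₁ p) ⟧

    freshAt-one : ∀ {b p} → aH hE p ≡ b → Fresh (f (false , p)) → freshAt b p ≡ 1
    freshAt-one {b} {p} eq fr =
      cong₂ _*_ (⟦⟧-yes (aH hE p Fin.≟ b) eq) (⟦⟧-yes (newEdge? (proj₁ p)) (fresh-zero (proj₂ p) fr))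

    freshDegree : Fin t → ℕ
    freshDegree b = ∑ (elements (listPos k)) (freshAt b)

    -- `paired` yields a second half-edge at `b`, and by `free-const` `T₁` has the same vertex of
    -- `G` there, so that one is fresh too.
    two≤freshDegree : ∀ b → ⟦ newFree? b ⟧ * 2 ≤ freshDegree b
    two≤freshDegree b = ⟦⟧-*-≤ (newFree? b) λ { ((free≡ , p , refl , p∈) , unseen) →
      let q , q≢p , q~p = paired p
          p-fresh = p∈ , λ p∈S → unseen (free≡ , p , refl , p∈S)
          q-fresh = subst Fresh (sym (free-const false {p} {q} free≡ q~p)) p-fresh
      in begin
        2                              ≡⟨ cong₂ _+_ (freshAt-one {p = p} refl p-fresh) (freshAt-one {p = q} q~p q-fresh) ⟨
        freshAt _ p + freshAt _ q      ≤⟨ ∑-≥-two-terms (freshAt _) (complete (listPos k) p) (complete (listPos k) q) (q≢p ∘ sym) ⟩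
        freshDegree _                  ∎ }
      where open ≤-Reasoning

    -- Handshake: each half-edge lies at one vertex of `H`, and each new arc has two half-edges.
    ∑-freshDegree : ∑ (allFin t) freshDegree ≤ newEdges * 2
    ∑-freshDegree = begin
      ∑ (allFin t) freshDegree
        ≡⟨ ∑-swap (allFin t) (elements (listPos k)) freshAt ⟩
      ∑ (elements (listPos k)) (λ p → ∑ (allFin t) (λ b → freshAt b p))
        ≤⟨ ∑-mono (elements (listPos k)) (λ p → begin
             ∑ (allFin t) (λ b → freshAt b p)
               ≡⟨ ∑-*ʳ (allFin t) (λ b → ⟦ aH hE p Fin.≟ b ⟧) ⟦ newEdge? (proj₁ p) ⟧ ⟩
             ∑ (allFin t) (λ b → ⟦ aH hE p Fin.≟ b ⟧) * ⟦ newEdge? (proj₁ p) ⟧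
               ≤⟨ *-monoˡ-≤ ⟦ newEdge? (proj₁ p) ⟧ (∑-at-most-one (aH hE p Fin.≟_) (Unique.allFin⁺ t) (λ e e′ → trans (sym e) e′)) ⟩
             1 * ⟦ newEdge? (proj₁ p) ⟧
               ≡⟨ *-identityˡ _ ⟩
             ⟦ newEdge? (proj₁ p) ⟧ ∎) ⟩
      ∑ (elements (listPos k)) (λ p → ⟦ newEdge? (proj₁ p) ⟧)
        ≡⟨ ∑-cartesianProduct (allFin k) (allFin 2) _ ⟩
      ∑ (allFin k) (λ i → ∑ (allFin 2) (λ _ → ⟦ newEdge? i ⟧))
        ≡⟨ ∑-cong (allFin k) (λ i → trans (∑-const (allFin 2) ⟦ newEdge? i ⟧) (*-comm 2 ⟦ newEdge? i ⟧)) ⟩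
      ∑ (allFin k) (λ i → ⟦ newEdge? i ⟧ * 2)
        ≡⟨ ∑-*ʳ (allFin k) _ 2 ⟩
      newEdges * 2 ∎
      where open ≤-Reasoning

    -- Every new free vertex has two fresh half-edges, and some fixed vertex has a further one.
    newFrees<newEdges : ∀ {h} → Fresh (f h) → newFrees < newEdges
    newFrees<newEdges fr with fixedFresh fr
    ... | p , fixed , p-fresh = *-cancelʳ-< 2 newFrees newEdges (begin-strict
      newFrees * 2                                 ≡⟨ ∑-*ʳ (allFin t) _ 2 ⟨
      ∑ (allFin t) (λ b → ⟦ newFree? b ⟧ * 2)      <⟨ ∑-mono-< (allFin t) two≤freshDegree (∈-allFin (aH hE p)) surplus ⟩
      ∑ (allFin t) freshDegree                     ≤⟨ ∑-freshDegree ⟩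
      newEdges * 2                                 ∎)
      where
      open ≤-Reasoning
      not-free : ¬ (FreeVisited S′ (aH hE p) × ¬ FreeVisited S (aH hE p))
      not-free ((free≡ , _) , _) with trans (sym free≡) fixed
      ... | ()
      surplus : ⟦ newFree? (aH hE p) ⟧ * 2 < freshDegree (aH hE p)
      surplus = begin-strict
        ⟦ newFree? (aH hE p) ⟧ * 2  ≡⟨ cong (_* 2) (⟦⟧-no (newFree? (aH hE p)) not-free) ⟩
        0                           <⟨ ≤-refl ⟩
        1                           ≡⟨ freshAt-one refl p-fresh ⟨
        freshAt (aH hE p) p         ≤⟨ ∑-≥-term (freshAt (aH hE p)) (complete (listPos k) p) ⟩
        freshDegree (aH hE p)       ∎

    -- The invariant bounds components plus visited free vertices by visited arcs of `T₁`. The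
    -- strictness in `newFrees<newEdges` pays for the additional component.
    gain : ∀ {h} → Fresh (f h) → ∀ {r} → r + freesVisited S ≤ edgesVisited S →
           suc r + freesVisited S′ ≤ edgesVisited S′
    gain fr {r} inv = begin
      suc r + freesVisited S′                    ≤⟨ +-monoʳ-≤ (suc r) frees′≤ ⟩
      suc r + (freesVisited S + newFrees)        ≡⟨ cong suc (+-assoc r _ _) ⟨
      suc (r + freesVisited S + newFrees)        ≡⟨ +-suc (r + freesVisited S) newFrees ⟨
      r + freesVisited S + suc newFrees          ≤⟨ +-mono-≤ inv (newFrees<newEdges fr) ⟩
      edgesVisited S + newEdges                  ≤⟨ ≤edges′ ⟩
      edgesVisited S′                            ∎
      where
      open ≤-Reasoning
      frees′≤ : freesVisited S′ ≤ freesVisited S + newFrees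
      frees′≤ = ≤-trans (∑-mono (allFin t) (λ b → ⟦⟧-≤-+ (freeVisited? S b) (freeVisited? S′ b)))
                        (≤-reflexive (∑-+ (allFin t) _ _))
      ≤edges′ : edgesVisited S + newEdges ≤ edgesVisited S′
      ≤edges′ = ≤-trans (≤-reflexive (sym (∑-+ (allFin k) _ _)))
                        (∑-mono (allFin k) (λ i → ⟦⟧-+-≤ (edgeVisited? S i) (edgeVisited? S′ i) S⊑S′))

  Complete : Set
  Complete = Σ[ V ∈ ℕ ] Σ[ S ∈ State V ]
    ((∀ h → S ∋ f h) × components (exploration S) + countB t free ≤ k)

  -- Each round starts a component at an unvisited half-edge and closes it, and `gain` renews the
  -- invariant. Once everything is visited, all free vertices are counted and at most `k` arcs are,
  -- which turns the invariant into the required bound.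
  explore : ∀ fuel {V} (S : State V) → n ≤ V + fuel → Closed S →
            components (exploration S) + freesVisited S ≤ edgesVisited S → Complete
  explore fuel {V} S n≤ closed inv with search (listHalfEdge k) (λ h → ¬? (S ∋? f h))
  ... | no none = V , S , all-visited , (begin
      components (exploration S) + countB t free      ≤⟨ +-monoʳ-≤ _ countB≤ ⟩
      components (exploration S) + freesVisited S     ≤⟨ inv ⟩
      edgesVisited S                                  ≤⟨ ∑-bound (allFin k) (λ {i} _ → ⟦⟧-≤1 (edgeVisited? S i)) ⟩
      length (allFin k) * 1                           ≡⟨ trans (*-identityʳ _) (length-tabulate {n = k} id) ⟩
      k                                               ∎)
    where
    open ≤-Reasoning
    all-visited : ∀ h → S ∋ f h
    all-visited h with S ∋? f h
    ... | yes v∈ = v∈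
    ... | no v∉  = contradiction (h , v∉) none
    free≤ : ∀ b → (if free b then 1 else 0) ≤ ⟦ freeVisited? S b ⟧
    -- `free-touched` excludes a free vertex without half-edges, which could never be visited.
    free≤ b = if-≤ (free b) λ free≡ → let p , p~b = free-touched b free≡ in
      ≤-reflexive (sym (⟦⟧-yes (freeVisited? S b) (free≡ , p , p~b , all-visited (false , p))))
    countB≤ : countB t free ≤ freesVisited S
    countB≤ = ≤-trans (≤-reflexive (sym (∑-allFin t _))) (∑-mono (allFin t) free≤)
  ... | yes ((s , i , u) , v∉) = grow fuel n≤
    where
    -- By closedness the missing end rules out the other end as well, so a whole arc can be added.
    unseen : ∀ u′ → ¬ S ∋ f (s , i , u′)
    unseen u′ w∈ = v∉ (reach u u′ w∈)
      where
      reach : ∀ u u′ → S ∋ f (s , i , u′) → S ∋ f (s , i , u)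
      reach zero       zero       w∈ = w∈
      reach zero       (suc zero) w∈ = closed s i (suc zero) w∈
      reach (suc zero) zero       w∈ = closed s i zero w∈
      reach (suc zero) (suc zero) w∈ = w∈
    S⁺ : State (2 + V)
    S⁺ = arcState S s i unseen
    grow : ∀ fuel → n ≤ V + fuel → Complete
    grow zero       n≤ = fuel-spent (n≤1+n (suc V)) (size≤n S⁺) n≤
    grow (suc fuel) n≤ with close fuel S⁺ (fuel-step fuel (n≤1+n (suc V)) n≤)
    ... | W , S′ , V<W , S⁺⊑ , closed′ , same =
      explore fuel S′ (fuel-step fuel (≤-trans (n≤1+n (suc V)) V<W) n≤) closed′
        (subst (λ r → r + freesVisited S′ ≤ edgesVisited S′) (sym same)
          (Growth.gain S S′ S⊑S′ closed closed′ {s , i , zero}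
            (S⁺⊑ (arcState-∋ S s i unseen zero) , unseen zero) inv))
      where
      S⊑S′ : S ⊑ S′
      S⊑S′ (l , eq) = S⁺⊑ (suc (suc l) , eq)

  complete-exploration : Complete
  complete-exploration = explore n empty ≤-refl (λ _ _ _ ()) (≤-trans (≤-reflexive none) z≤n)
    where
    none : freesVisited empty ≡ 0
    none = trans (∑-cong (allFin t) (λ b → ⟦⟧-no (freeVisited? empty b) λ { (_ , _ , _ , () , _) }))
                 (trans (∑-const (allFin t) 0) (*-zeroʳ (length (allFin t))))

  -- Every explored vertex lies on two half-edges, and there are 4k half-edges.
  size≤2k : ∀ {V} → State V → V ≤ 2 * k
  size≤2k {V} S = *-cancelʳ-≤ V (2 * k) 2 (begin
    V * 2
      ≡⟨ trans (∑-const (allFin V) 2) (cong (_* 2) (length-tabulate {n = V} id)) ⟨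
    ∑ (allFin V) (λ _ → 2)
      ≤⟨ ∑-mono (allFin V) twice ⟩
    ∑ (allFin V) (λ l → ∑ halfEdges (λ h → ⟦ hits? l h ⟧))
      ≡⟨ ∑-swap (allFin V) halfEdges _ ⟩
    ∑ halfEdges (λ h → ∑ (allFin V) (λ l → ⟦ hits? l h ⟧))
      ≤⟨ ∑-bound halfEdges (λ {h} _ → ∑-at-most-one (λ l → hits? l h) (Unique.allFin⁺ V)
           (λ e e′ → distinct S (trans (sym e) e′))) ⟩
    length halfEdges * 1
      ≡⟨ *-identityʳ _ ⟩
    length halfEdges
      ≡⟨ trans (length-cartesianProductWith _,_ (elements listBool) (elements (listPos k)))
               (cong (2 *_) (trans (length-cartesianProductWith _,_ (allFin k) (allFin 2)) (cong (_* 2) (length-tabulate {n = k} id)))) ⟩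
    2 * (k * 2)
      ≡⟨ *-assoc 2 k 2 ⟨
    2 * k * 2 ∎)
    where
    open ≤-Reasoning
    halfEdges = elements (listHalfEdge k)
    hits? : ∀ l h → Dec (f h ≡ lookup (vertices S) l)
    hits? l h = f h Fin.≟ lookup (vertices S) l
    -- At a free vertex the second half-edge is in the same tuple, at a fixed one in the other
    -- tuple.
    partner : ∀ h → ∃[ h′ ] (h′ ≢ h × f h′ ≡ f h)
    partner (s , p) with free (aH hE p) in free≡
    ... | true  = let q , q≢p , q~p = paired p in (s , q) , q≢p ∘ cong proj₂ , free-const s free≡ q~p
    ... | false = let q , _ , eq = swap s p free≡ in (not s , q) , (λ e → not≢ s (cong proj₁ e)) , eq
      where
      not≢ : ∀ b → not b ≢ b
      not≢ true  ()
      not≢ false ()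
    twice : ∀ l → 2 ≤ ∑ halfEdges (λ h → ⟦ hits? l h ⟧)
    twice l = begin
      2                                            ≡⟨ cong₂ _+_ (⟦⟧-yes (hits? l h) (origin-f S l)) (⟦⟧-yes (hits? l h′) (trans eq (origin-f S l))) ⟨
      ⟦ hits? l h ⟧ + ⟦ hits? l h′ ⟧               ≤⟨ ∑-≥-two-terms _ (complete (listHalfEdge k) h) (complete (listHalfEdge k) h′) (h′≢h ∘ sym) ⟩
      ∑ halfEdges (λ h → ⟦ hits? l h ⟧)            ∎
      where
      h    = lookup (origin S) l
      h′   = proj₁ (partner h)
      h′≢h = proj₁ (proj₂ (partner h))
      eq   = proj₂ (proj₂ (partner h))

-- From good pairs to patterns

does-true⇒ : (d : Dec P) → does d ≡ true → P
does-true⇒ (yes p) _ = p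

does-false⇒ : (d : Dec P) → does d ≡ false → ¬ P
does-false⇒ (no ¬p) _ = ¬p

lookup-injective : ∀ {n} {xs ys : Vec A n} → (∀ i → lookup xs i ≡ lookup ys i) → xs ≡ ys
lookup-injective {xs = xs} {ys} eq =
  trans (sym (Vec.tabulate∘lookup xs)) (trans (Vec.tabulate-cong eq) (Vec.tabulate∘lookup ys))

-- Without a second half-edge, the list `p ∷ []` would count the half-edges at the vertex, making it
-- a leaf.
noLeaf-partner : ∀ {t k} (hE : Vec (Fin t × Fin t) k) → NoLeavesH hE →
  ∀ p → ∃[ q ] (q ≢ p × aH hE q ≡ aH hE p)
noLeaf-partner {k = k} hE noLeaves p
  with search (listPos k) (λ q → ¬? (Product.≡-dec Fin._≟_ Fin._≟_ q p) ×-dec (aH hE q Fin.≟ aH hE p))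
... | yes found = found
... | no none   = contradiction refl (noLeaves (aH hE p) 1
  (p ∷ [] , [] ∷ [] , refl , λ q → (λ { (here refl) → refl }) , only q))
  where
  only : ∀ q → aH hE q ≡ aH hE p → q ∈ p ∷ []
  only q q~p with Product.≡-dec Fin._≟_ Fin._≟_ q p
  ... | yes refl = here refl
  ... | no q≢p   = contradiction (q , q≢p , q~p) none

module FromGood {t k n C : ℕ} (hE : Vec (Fin t × Fin t) k) (conn : IsConnectedH hE) (noLeaves : NoLeavesH hE)
  (G : SimpleGraph n) (col : Fin n → Fin C) (T₁ T₂ : Tuple n k) (good : Good hE G col (T₁ , T₂)) where

  f : HalfEdge k → Fin n
  f (s , p) = pos (if s then T₂ else T₁) p

  arc₁       = proj₁ good
  arc₂       = proj₁ (proj₂ good)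
  compat₁    = proj₁ (proj₂ (proj₂ good))
  compat₂    = proj₁ (proj₂ (proj₂ (proj₂ good)))
  conditions = proj₁ (proj₂ (proj₂ (proj₂ (proj₂ good))))
  special    = proj₂ (proj₂ (proj₂ (proj₂ (proj₂ good))))

  f-adj : ∀ s i u → adj G (f (s , i , u)) (f (s , i , other u)) ≡ true
  f-adj false i zero       = arc₁ i
  f-adj false i (suc zero) = trans (adj-sym G _ _) (arc₁ i)
  f-adj true  i zero       = arc₂ i
  f-adj true  i (suc zero) = trans (adj-sym G _ _) (arc₂ i)

  Matched : HalfEdge k → Set
  Matched (s , p) = ∃[ q ] (aH hE q ≡ aH hE p × f (not s , q) ≡ f (s , p))

  matched? : ∀ h → Dec (Matched h)
  matched? (s , p) = search (listPos k) (λ q → (aH hE q Fin.≟ aH hE p) ×-dec (f (not s , q) Fin.≟ f (s , p)))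

  -- b is free when T₁ and T₂ do not use the same set of vertices of G at b; this forces Condition 1.
  Free : Fin t → Set
  Free b = ∃[ h ] (aH hE (proj₂ h) ≡ b × ¬ Matched h)

  free? : ∀ b → Dec (Free b)
  free? b = search (listHalfEdge k) (λ h → (aH hE (proj₂ h) Fin.≟ b) ×-dec ¬? (matched? h))

  free : Fin t → Bool
  free b = does (free? b)

  swap : ∀ s p → free (aH hE p) ≡ false → Matched (s , p)
  swap s p fixed with matched? (s , p)
  ... | yes m = m
  ... | no ¬m = contradiction ((s , p) , refl , ¬m) (does-false⇒ (free? (aH hE p)) fixed)

  free-touched : ∀ b → free b ≡ true → ∃[ p ] aH hE p ≡ b
  free-touched b free≡ with does-true⇒ (free? b) free≡
  ... | (_ , p) , p~b , _ = p , p~b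

  condition2-fixed : ∀ {b} → Condition2 hE b T₁ T₂ → ¬ Free b
  condition2-fixed cond ((false , p) , p~b , ¬m) = ¬m (p , refl , sym (cond p p~b))
  condition2-fixed cond ((true  , p) , p~b , ¬m) = ¬m (p , refl , cond p p~b)

  -- If both orientations of `(x , y)` occur at `b`, any half-edge there is matched by one of the
  -- opposite orientation, so `b` is not free. Hence one orientation is missing and both tuples are
  -- constant at `b`.
  condition3-free : ∀ {b} → Condition3 hE b T₁ T₂ → Free b → Condition1 hE b T₁ T₂
  condition3-free {b} (x , y , cond) (h , h~b , ¬m) with oriented? x y | oriented? y x
    where
    oriented? : ∀ v w → Dec (∃[ p ] (aH hE p ≡ b × pos T₁ p ≡ v × pos T₂ p ≡ w))
    oriented? v w = search (listPos k) (λ p →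
      (aH hE p Fin.≟ b) ×-dec (pos T₁ p Fin.≟ v) ×-dec (pos T₂ p Fin.≟ w))
  ... | yes (p , p~b , p₁ , p₂) | yes (q , q~b , q₁ , q₂) = contradiction (matched h h~b) ¬m
    where
    matched : ∀ h → aH hE (proj₂ h) ≡ b → Matched h
    matched (s , r) r~b with s | cond r r~b
    ... | false | inj₁ (r₁ , r₂) = q , trans q~b (sym r~b) , trans q₂ (sym r₁)
    ... | false | inj₂ (r₁ , r₂) = p , trans p~b (sym r~b) , trans p₂ (sym r₁)
    ... | true  | inj₁ (r₁ , r₂) = q , trans q~b (sym r~b) , trans q₁ (sym r₂)
    ... | true  | inj₂ (r₁ , r₂) = p , trans p~b (sym r~b) , trans p₁ (sym r₂)
  ... | no none | _ = λ p q p~b q~b → let p₁ , p₂ = at p p~b ; q₁ , q₂ = at q q~b in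
      trans p₁ (sym q₁) , trans p₂ (sym q₂)
    where
    at : ∀ p → aH hE p ≡ b → pos T₁ p ≡ y × pos T₂ p ≡ x
    at p p~b with cond p p~b
    ... | inj₁ e = contradiction (p , p~b , e) none
    ... | inj₂ e = e
  ... | yes _ | no none = λ p q p~b q~b → let p₁ , p₂ = at p p~b ; q₁ , q₂ = at q q~b in
      trans p₁ (sym q₁) , trans p₂ (sym q₂)
    where
    at : ∀ p → aH hE p ≡ b → pos T₁ p ≡ x × pos T₂ p ≡ y
    at p p~b with cond p p~b
    ... | inj₁ e = e
    ... | inj₂ e = contradiction (p , p~b , e) none

  free-condition1 : ∀ {b} → Free b → Condition1 hE b T₁ T₂
  free-condition1 {b} fr with conditions b
  ... | inj₁ cond        = cond
  ... | inj₂ (inj₁ cond) = contradiction fr (condition2-fixed cond)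
  ... | inj₂ (inj₂ cond) = condition3-free cond fr

  free-const : ∀ s {p q} → free (aH hE p) ≡ true → aH hE q ≡ aH hE p → f (s , q) ≡ f (s , p)
  free-const s {p} {q} free≡ q~p with s | free-condition1 (does-true⇒ (free? (aH hE p)) free≡) q p q~p refl
  ... | false | eq₁ , _ = eq₁
  ... | true  | _ , eq₂ = eq₂

  anchor-fixed : free (proj₁ special) ≡ false
  anchor-fixed with free (proj₁ special) in free≡
  ... | false = refl
  ... | true  = contradiction (does-true⇒ (free? (proj₁ special)) free≡) (condition2-fixed (proj₂ special))

  open Explore hE conn G f f-adj free (noLeaf-partner hE noLeaves) free-const swap free-touched
    (proj₁ special) anchor-fixed
  open State

  -- At a fixed vertex `colours₂` takes the colour of `T₁`, so that the agreement demanded by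
  -- `∈-colouringPairs` holds by construction.
  colours₁ colours₂ : Vec (Fin C) t
  colours₁ = Vec.tabulate (proj₁ compat₁)
  colours₂ = Vec.tabulate (λ b → if free b then proj₁ compat₂ b else proj₁ compat₁ b)

  colour-f : ∀ s p → col (f (s , p)) ≡ lookup (if s then colours₂ else colours₁) (aH hE p)
  colour-f false p = trans (proj₂ (proj₂ compat₁) p) (sym (Vec.lookup∘tabulate (proj₁ compat₁) (aH hE p)))
  colour-f true p  = trans colour-if (sym (Vec.lookup∘tabulate _ (aH hE p)))
    where
    colour-if : col (pos T₂ p) ≡ (if free (aH hE p) then proj₁ compat₂ (aH hE p) else proj₁ compat₁ (aH hE p))
    colour-if with free (aH hE p) in free≡
    ... | true  = proj₂ (proj₂ compat₂) p
    -- The vertex of `T₂` at a fixed vertex of `H` also occurs there in `T₁`, so its colour is the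
    -- one that `T₁` prescribes.
    ... | false with swap true p free≡
    ... | q , q~p , eq = trans (cong col (sym eq)) (trans (proj₂ (proj₂ compat₁) q) (cong (proj₁ compat₁) q~p))

  -- The completed exploration gives the pattern: `visited` locates every half-edge among the
  -- explored vertices, which makes `decode` recover the pair, and `origin` supplies the half-edges
  -- through which colours are prescribed.
  pattern-of-good : ∀ {F} (fam : Fin F → Fin n → Fin C) j → fam j ≡ col →
    Σ[ π ∈ Pattern t k ] (Admissible π × Σ[ i ∈ Instance hE G fam π ]
      (i ∈ instances hE G fam π × Realises hE G fam j π i × decode π (proj₁ i) ≡ (T₁ , T₂)))
  pattern-of-good fam j refl with complete-exploration
  ... | W , S , visited , bound = π , (size≤2k S , subst (λ z → components (exploration S) + z ≤ k) (sym count≡) bound)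
      , (vertices S , colours₁ , colours₂)
      , ∈-cartesianProduct⁺ (∈-filter⁺ distinct? (embedded S) (distinct S))
          (∈-colouringPairs (Vec.tabulate free) colours-agree)
      , lookup-injective realised
      , cong₂ _,_ (decode≡ false) (decode≡ true)
    where
    at : Bool → Fin k → Fin W × Fin W
    at s i = proj₁ (visited (s , i , zero)) , proj₁ (visited (s , i , suc zero))
    π : Pattern t k
    π = pattern′ W (exploration S) (Vec.tabulate (at false) , Vec.tabulate (at true)) (origin S) (Vec.tabulate free)
    count≡ : freeCount π ≡ countB t free
    count≡ = trans (sym (∑-allFin t _))
      (trans (∑-cong (allFin t) (λ b → cong (λ c → if c then 1 else 0) (Vec.lookup∘tabulate free b))) (∑-allFin t _))
    colours-agree : ∀ b → lookup (Vec.tabulate free) b ≡ false → lookup colours₂ b ≡ lookup colours₁ b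
    colours-agree b fixed = trans (Vec.lookup∘tabulate _ b)
      (trans (cong (λ c → if c then proj₁ compat₂ b else proj₁ compat₁ b) (trans (sym (Vec.lookup∘tabulate free b)) fixed))
             (sym (Vec.lookup∘tabulate (proj₁ compat₁) b)))
    realised : ∀ l → lookup (Vec.map col (vertices S)) l ≡
                     lookup (prescribed hE G fam π (colours₁ , colours₂)) l
    realised l = trans (Vec.lookup-map l col (vertices S)) (trans (cong col (sym (origin-f S l)))
      (trans (colour-f (proj₁ (lookup (origin S) l)) (proj₂ (lookup (origin S) l))) (sym (Vec.lookup-map l _ (origin S)))))
    decode≡ : ∀ s → Vec.map (λ (v , w) → lookup (vertices S) v , lookup (vertices S) w) (Vec.tabulate (at s))
                    ≡ (if s then T₂ else T₁)
    decode≡ s = lookup-injective (λ i → trans (Vec.lookup-map i _ (Vec.tabulate (at s)))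
      (trans (cong (λ (v , w) → lookup (vertices S) v , lookup (vertices S) w) (Vec.lookup∘tabulate (at s) i))
             (cong₂ _,_ (proj₂ (visited (s , i , zero))) (proj₂ (visited (s , i , suc zero))))))

theorem3p10 : (t k : ℕ) → 1 ≤ t → (hE : Vec (Fin t × Fin t) k) →
    IsSimpleH hE → IsConnectedH hE → NoLeavesH hE →
    Σ[ K ∈ ℕ ] ((n : ℕ) (G : SimpleGraph n) (C F : ℕ) (fam : Fin F → Fin n → Fin C) →
    maxDeg G * maxDeg G < numArcs G →
    maxDeg G * maxDeg G * C ≤ numArcs G →
    t ≤ C → C ^ 3 ≤ numArcs G →
    0 < F → IsIndependentFamily (4 * k) fam →
    (N : Fin F → ℕ) → ((j : Fin F) → IsCount (Good hE G (fam j)) (N j)) →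
    sumFin F N * C ^ (2 * k) ≤ K * numArcs G ^ k * C ^ t * F)
-- The constant is the number of admissible patterns, which depends on `t` and `k` alone;
-- `1 ≤ t ≤ C` makes `C` positive.
theorem3p10 t k 1≤t hE _ conn noLeaves = length (patterns t k) ,
  λ n G C F fam _ Δ²C≤m t≤C C³≤m _ independent N counts →
    expectation-bound hE G fam (≤-trans 1≤t t≤C) independent Δ²C≤m C³≤m N
      (λ j → count-≤-realisations hE G fam j (counts j)
        (λ {(T₁ , T₂)} good → FromGood.pattern-of-good hE conn noLeaves G (fam j) T₁ T₂ good fam j refl))
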